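{- Let $G$ be a penny graph with vertices in general position and let $A$ be a vertex of degree $4$. Then it is impossible that all four edges at $A$ are of Type II.
   Context: A penny graph is a graph whose vertex set is a finite set $P$ of points in the Euclidean plane such that every two distinct points of $P$ are at distance at least $1$, and whose edges are exactly the pairs of points of $P$ at distance exactly $1$. The vertices are in general position if no three of them are collinear. A vertex is popular if it has degree $5$, at most one of its neighbors has degree $4$, and all its other neighbors have degree $5$. For a vertex $A$ of degree $4$ and a neighbor $B$ of $A$, the edge $AB$ is of Type II if $B$ is popular and the five neighbors of $B$ can be labeled $C_1,C_2,C_3,C_4,C_5$ in clockwise rotational order around $B$ so that $C_1C_2$, $C_3C_4$ and $C_4C_5$ are edges and $A=C_5$. -}

module Defs where

open import Level using (0ℓ)
open import Data.Nat using (ℕ)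
open import Data.Fin using (Fin; zero; suc) renaming (_<_ to _<ᶠ_)
open import Data.Product using (Σ; ∃; _×_; _,_)
open import Data.Sum using (_⊎_)
open import Data.Empty using (⊥)
open import Relation.Nullary using (¬_)
open import Relation.Binary.PropositionalEquality using (_≡_; _≢_)
open import Function.Definitions using (Injective)

-- The real numbers, axiomatised as a Dedekind-complete ordered field.
-- (Any two such structures are isomorphic, so quantifying over all of
-- them is the same as speaking about ℝ.)

record RealField : Set₁ where
  infixl 6 _+_ _-_
  infixl 7 _*_
  infix 4 _<_ _≤_
  field
    ℝ    : Set
    𝟘 𝟙  : ℝ
    _+_ _*_ : ℝ → ℝ → ℝ
    -_   : ℝ → ℝ
    _<_  : ℝ → ℝ → Set
    +-assoc : ∀ x y z → (x + y) + z ≡ x + (y + z)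
    +-comm  : ∀ x y → x + y ≡ y + x
    +-idˡ   : ∀ x → 𝟘 + x ≡ x
    +-invˡ  : ∀ x → (- x) + x ≡ 𝟘
    *-assoc : ∀ x y z → (x * y) * z ≡ x * (y * z)
    *-comm  : ∀ x y → x * y ≡ y * x
    *-idˡ   : ∀ x → 𝟙 * x ≡ x
    distribˡ : ∀ x y z → x * (y + z) ≡ x * y + x * z
    𝟘≢𝟙    : 𝟘 ≢ 𝟙
    *-inv  : ∀ x → x ≢ 𝟘 → ∃ λ y → y * x ≡ 𝟙
    <-irrefl : ∀ x → ¬ (x < x)
    <-trans  : ∀ x y z → x < y → y < z → x < z
    <-tri    : ∀ x y → x < y ⊎ x ≡ y ⊎ y < x
    +-mono-< : ∀ x y z → x < y → x + z < y + z
    *-pos    : ∀ x y → 𝟘 < x → 𝟘 < y → 𝟘 < x * y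

  _-_ : ℝ → ℝ → ℝ
  x - y = x + (- y)

  _≤_ : ℝ → ℝ → Set
  x ≤ y = x < y ⊎ x ≡ y

  field
    sup : (S : ℝ → Set) → (∃ λ x → S x) → (∃ λ b → ∀ x → S x → x ≤ b) →
          ∃ λ s → (∀ x → S x → x ≤ s) × (∀ b → (∀ x → S x → x ≤ b) → s ≤ b)

module Geometry (R : RealField) where
  open RealField R

  Point : Set
  Point = ℝ × ℝ

  dist² : Point → Point → ℝ
  dist² (x₁ , y₁) (x₂ , y₂) = (x₁ - x₂) * (x₁ - x₂) + (y₁ - y₂) * (y₁ - y₂)

  -- orientation determinant of (a, b, c): negative means clockwise
  orient : Point → Point → Point → ℝ
  orient (ax , ay) (bx , by) (cx , cy) =
    (bx - ax) * (cy - ay) - (by - ay) * (cx - ax)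

  module _ {n : ℕ} (p : Fin n → Point) where

    IsPennyPointSet : Set
    IsPennyPointSet = ∀ i j → i ≢ j → 𝟙 ≤ dist² (p i) (p j)

    Adj : Fin n → Fin n → Set
    Adj i j = i ≢ j × dist² (p i) (p j) ≡ 𝟙

    GeneralPosition : Set
    GeneralPosition = ∀ i j k → i ≢ j → j ≢ k → i ≢ k →
                      orient (p i) (p j) (p k) ≢ 𝟘

    HasDegree : Fin n → ℕ → Set
    HasDegree i d = Σ (Fin d → Fin n) λ f →
      Injective _≡_ _≡_ f × (∀ j → Adj i j → ∃ λ m → f m ≡ j) × (∀ m → Adj i (f m))

    Popular : Fin n → Set
    Popular b = HasDegree b 5
      × (∀ j → Adj b j → HasDegree j 4 ⊎ HasDegree j 5)
      × (∀ j k → Adj b j → Adj b k → HasDegree j 4 → HasDegree k 4 → j ≡ k)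

    -- c 0, …, c 4 (all on the unit circle around b) appear in clockwise
    -- cyclic order: every triple taken in label order is oriented clockwise.
    ClockwiseAround : Fin n → (Fin 5 → Fin n) → Set
    ClockwiseAround b c = ∀ i j k → i <ᶠ j → j <ᶠ k →
      orient (p (c i)) (p (c j)) (p (c k)) < 𝟘

    TypeII : Fin n → Fin n → Set
    TypeII a b = Popular b × Σ (Fin 5 → Fin n) λ c →
        Injective _≡_ _≡_ c
      × (∀ m → Adj b (c m))
      × (∀ j → Adj b j → ∃ λ m → c m ≡ j)
      × ClockwiseAround b c
      × Adj (c c₁) (c c₂) × Adj (c c₃) (c c₄) × Adj (c c₄) (c c₅)
      × c c₅ ≡ a
      where
        c₁ c₂ c₃ c₄ c₅ : Fin 5
        c₁ = zero
        c₂ = suc zero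
        c₃ = suc (suc zero)
        c₄ = suc (suc (suc zero))
        c₅ = suc (suc (suc (suc zero)))

-- If every edge at a is of Type II, then for each neighbour b of a the neighbour C₄ of b
-- preceding a = C₅ is again a neighbour of a, and a b C₄ is a clockwise unit triangle:
-- C₁, at distance ≥ 1 from both C₄ and a, lies on the far arc of the unit circle about b,
-- which fixes the orientation. In complex coordinates centred at a, passing from b to C₄
-- multiplies by (1 + iσ)/2 with σ = -√3, a rotation by -60°. Three such steps from a
-- neighbour b₁ rotate by 180°, so the third vertex b₄ reached is the reflection of b₁ in a:
-- b₁, a, b₄ are collinear, contradicting general position.
module Submission where

open import Defs
open import Level using (0ℓ)
open import Data.Nat as ℕ using (ℕ; zero; suc)
open import Data.Integer as ℤ using (ℤ; -[1+_]; _⊖_; _◃_; sign; ∣_∣)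
import Data.Integer.Properties as ℤ
open import Data.Nat.Properties using (+-suc; n<1+n)
open import Data.Sign as Sign using (Sign)
open import Data.Maybe using (Maybe; just; nothing)
open import Data.Fin as Fin using (Fin; zero; #_)
open import Data.Product using (∃; _×_; _,_; proj₁; proj₂)
open import Data.Sum using (inj₁; inj₂)
open import Relation.Nullary using (¬_; yes; no; contradiction)
open import Relation.Binary.PropositionalEquality
open import Algebra.Bundles using (CommutativeRing)
open import Algebra.Consequences.Propositional using (comm∧idˡ⇒id; comm∧invˡ⇒inv; comm∧distrˡ⇒distrʳ)
open import Algebra.Solver.Ring.AlmostCommutativeRing using (fromCommutativeRing; _-Raw-AlmostCommutative⟶_)

module RealFieldRing (R : RealField) where
  open RealField R

  commutativeRing : CommutativeRing 0ℓ 0ℓ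
  commutativeRing = record
    { Carrier = ℝ ; _≈_ = _≡_ ; _+_ = _+_ ; _*_ = _*_ ; -_ = λ x → - x ; 0# = 𝟘 ; 1# = 𝟙
    ; isCommutativeRing = record
      { isRing = record
        { +-isAbelianGroup = record
          { isGroup = record
            { isMonoid = record
              { isSemigroup = record
                { isMagma = record { isEquivalence = isEquivalence ; ∙-cong = cong₂ _+_ }
                ; assoc = +-assoc }
              ; identity = comm∧idˡ⇒id +-comm +-idˡ }
            ; inverse = comm∧invˡ⇒inv +-comm +-invˡ
            ; ⁻¹-cong = cong (λ x → - x) }
          ; comm = +-comm }
        ; *-cong = cong₂ _*_
        ; *-assoc = *-assoc
        ; *-identity = comm∧idˡ⇒id *-comm *-idˡ
        ; distrib = distribˡ , comm∧distrˡ⇒distrʳ *-comm distribˡ }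
      ; *-comm = *-comm } }

  open CommutativeRing commutativeRing using (ring; semiring)
  open CommutativeRing commutativeRing public using (+-identityʳ; -‿inverseʳ; *-identityʳ; zeroˡ; zeroʳ)
  open import Algebra.Properties.Ring ring using (-0#≈0#; -‿involutive; -‿distribˡ-*; -‿distribʳ-*)
  open import Algebra.Properties.Ring ring public using (-‿+-comm)
  open import Algebra.Properties.Semiring.Mult.TCOptimised semiring
    renaming (_×_ to _·ℕ_) using (1+×; ×-homo-+; ×1-homo-*)

  fromℕ : ℕ → ℝ
  fromℕ n = n ·ℕ 𝟙

  fromℕ-suc : ∀ n → fromℕ (suc n) ≡ 𝟙 + fromℕ n
  fromℕ-suc n = 1+× n 𝟙

  fromℤ : ℤ → ℝ
  fromℤ (ℤ.+ n)  = fromℕ n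
  fromℤ -[1+ n ] = - fromℕ (suc n)

  private
    1+x-[1+y]≡x-y : ∀ x y → (𝟙 + x) - (𝟙 + y) ≡ x - y
    1+x-[1+y]≡x-y x y = begin
      (𝟙 + x) + - (𝟙 + y)      ≡⟨ cong ((𝟙 + x) +_) (sym (-‿+-comm 𝟙 y)) ⟩
      (𝟙 + x) + (- 𝟙 + - y)    ≡⟨ cong (_+ (- 𝟙 + - y)) (+-comm 𝟙 x) ⟩
      (x + 𝟙) + (- 𝟙 + - y)    ≡⟨ +-assoc x 𝟙 _ ⟩
      x + (𝟙 + (- 𝟙 + - y))    ≡⟨ cong (x +_) (sym (+-assoc 𝟙 (- 𝟙) (- y))) ⟩
      x + ((𝟙 + - 𝟙) + - y)    ≡⟨ cong (λ t → x + (t + - y)) (-‿inverseʳ 𝟙) ⟩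
      x + (𝟘 + - y)            ≡⟨ cong (x +_) (+-idˡ (- y)) ⟩
      x - y                    ∎
      where open ≡-Reasoning

    fromℤ-⊖ : ∀ m n → fromℤ (m ⊖ n) ≡ fromℕ m - fromℕ n
    fromℤ-⊖ zero    zero    = sym (trans (+-idˡ (- 𝟘)) -0#≈0#)
    fromℤ-⊖ zero    (suc n) = sym (+-idˡ _)
    fromℤ-⊖ (suc m) zero    = sym (trans (cong (fromℕ (suc m) +_) -0#≈0#) (+-identityʳ _))
    fromℤ-⊖ (suc m) (suc n) = begin
      fromℤ (suc m ⊖ suc n)           ≡⟨ cong fromℤ (ℤ.[1+m]⊖[1+n]≡m⊖n m n) ⟩
      fromℤ (m ⊖ n)                   ≡⟨ fromℤ-⊖ m n ⟩
      fromℕ m - fromℕ n               ≡⟨ sym (1+x-[1+y]≡x-y (fromℕ m) (fromℕ n)) ⟩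
      (𝟙 + fromℕ m) - (𝟙 + fromℕ n)   ≡⟨ sym (cong₂ _-_ (fromℕ-suc m) (fromℕ-suc n)) ⟩
      fromℕ (suc m) - fromℕ (suc n)   ∎
      where open ≡-Reasoning

    fromℤ-+ : ∀ i j → fromℤ (i ℤ.+ j) ≡ fromℤ i + fromℤ j
    fromℤ-+ (ℤ.+ m)  (ℤ.+ n)  = ×-homo-+ 𝟙 m n
    fromℤ-+ (ℤ.+ m)  -[1+ n ] = fromℤ-⊖ m (suc n)
    fromℤ-+ -[1+ m ] (ℤ.+ n)  = trans (fromℤ-⊖ n (suc m)) (+-comm _ _)
    fromℤ-+ -[1+ m ] -[1+ n ] =
      trans (cong (λ k → - fromℕ k) (sym (+-suc (suc m) n)))
            (trans (cong (λ x → - x) (×-homo-+ 𝟙 (suc m) (suc n))) (sym (-‿+-comm _ _)))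

    signed : Sign → ℝ → ℝ
    signed Sign.+ x = x
    signed Sign.- x = - x

    fromℤ-◃ : ∀ s n → fromℤ (s ◃ n) ≡ signed s (fromℕ n)
    fromℤ-◃ Sign.+ zero    = refl
    fromℤ-◃ Sign.- zero    = sym -0#≈0#
    fromℤ-◃ Sign.+ (suc n) = refl
    fromℤ-◃ Sign.- (suc n) = refl

    fromℤ-signAbs : ∀ i → fromℤ i ≡ signed (sign i) (fromℕ ∣ i ∣)
    fromℤ-signAbs (ℤ.+ zero)  = refl
    fromℤ-signAbs (ℤ.+ suc n) = refl
    fromℤ-signAbs -[1+ n ]    = refl

    signed-* : ∀ s t x y → signed (s Sign.* t) (x * y) ≡ signed s x * signed t y
    signed-* Sign.+ Sign.+ x y = refl
    signed-* Sign.+ Sign.- x y = -‿distribʳ-* x y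
    signed-* Sign.- Sign.+ x y = -‿distribˡ-* x y
    signed-* Sign.- Sign.- x y = begin
      x * y           ≡⟨ sym (-‿involutive _) ⟩
      - - (x * y)     ≡⟨ cong (λ x → - x) (-‿distribʳ-* x y) ⟩
      - (x * - y)     ≡⟨ -‿distribˡ-* x (- y) ⟩
      - x * - y       ∎
      where open ≡-Reasoning

    fromℤ-* : ∀ i j → fromℤ (i ℤ.* j) ≡ fromℤ i * fromℤ j
    fromℤ-* i j = begin
      fromℤ (i ℤ.* j)                                            ≡⟨ fromℤ-◃ (sign i Sign.* sign j) (∣ i ∣ ℕ.* ∣ j ∣) ⟩
      signed (sign i Sign.* sign j) (fromℕ (∣ i ∣ ℕ.* ∣ j ∣))    ≡⟨ cong (signed (sign i Sign.* sign j)) (×1-homo-* ∣ i ∣ ∣ j ∣) ⟩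
      signed (sign i Sign.* sign j) (fromℕ ∣ i ∣ * fromℕ ∣ j ∣)  ≡⟨ signed-* (sign i) (sign j) _ _ ⟩
      signed (sign i) (fromℕ ∣ i ∣) * signed (sign j) (fromℕ ∣ j ∣) ≡⟨ sym (cong₂ _*_ (fromℤ-signAbs i) (fromℤ-signAbs j)) ⟩
      fromℤ i * fromℤ j                                          ∎
      where open ≡-Reasoning

    fromℤ-neg : ∀ i → fromℤ (ℤ.- i) ≡ - fromℤ i
    fromℤ-neg (ℤ.+ zero)  = sym -0#≈0#
    fromℤ-neg (ℤ.+ suc n) = refl
    fromℤ-neg -[1+ n ]    = sym (-‿involutive _)

    fromℤ-homomorphism : CommutativeRing.rawRing ℤ.+-*-commutativeRing -Raw-AlmostCommutative⟶ fromCommutativeRing commutativeRing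
    fromℤ-homomorphism = record
      { ⟦_⟧ = fromℤ ; +-homo = fromℤ-+ ; *-homo = fromℤ-* ; -‿homo = fromℤ-neg
      ; 0-homo = refl ; 1-homo = refl }

    fromℤ-≟ : ∀ i j → Maybe (fromℤ i ≡ fromℤ j)
    fromℤ-≟ i j with i ℤ.≟ j
    ... | yes refl = just refl
    ... | no _     = nothing

  -- ℝ has no decidable equality, so the ring solver computes with integer coefficients.
  open import Algebra.Solver.Ring (CommutativeRing.rawRing ℤ.+-*-commutativeRing)
    (fromCommutativeRing commutativeRing) fromℤ-homomorphism fromℤ-≟ public
    using (solve; _:=_; _:+_; _:*_; _:-_; :-_; con; Polynomial)

module RealFieldOrder (R : RealField) where
  open RealField R
  open RealFieldRing R

  x<y⇒0<y-x : ∀ {x y} → x < y → 𝟘 < y - x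
  x<y⇒0<y-x {x} {y} x<y = subst (_< y - x) (-‿inverseʳ x) (+-mono-< x y (- x) x<y)

  x<0⇒0<-x : ∀ {x} → x < 𝟘 → 𝟘 < - x
  x<0⇒0<-x {x} x<0 = subst (𝟘 <_) (+-idˡ (- x)) (x<y⇒0<y-x x<0)

  0<x⇒x≢0 : ∀ {x} → 𝟘 < x → x ≢ 𝟘
  0<x⇒x≢0 0<x refl = <-irrefl 𝟘 0<x

  0<x⇒0<x+y : ∀ {x y} → 𝟘 < x → 𝟘 ≤ y → 𝟘 < x + y
  0<x⇒0<x+y {x} {y} 0<x (inj₁ 0<y) =
    <-trans 𝟘 x (x + y) 0<x (subst₂ _<_ (+-idˡ x) (+-comm y x) (+-mono-< 𝟘 y x 0<y))
  0<x⇒0<x+y {x} 0<x (inj₂ refl) = subst (𝟘 <_) (sym (+-identityʳ x)) 0<x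

  0<y⇒0<x+y : ∀ {x y} → 𝟘 ≤ x → 𝟘 < y → 𝟘 < x + y
  0<y⇒0<x+y {x} {y} 0≤x 0<y = subst (𝟘 <_) (+-comm y x) (0<x⇒0<x+y 0<y 0≤x)

  0≤x+y : ∀ {x y} → 𝟘 ≤ x → 𝟘 ≤ y → 𝟘 ≤ x + y
  0≤x+y (inj₁ 0<x)  0≤y = inj₁ (0<x⇒0<x+y 0<x 0≤y)
  0≤x+y (inj₂ refl) 0≤y = subst (𝟘 ≤_) (sym (+-idˡ _)) 0≤y

  0≤x*y : ∀ {x y} → 𝟘 ≤ x → 𝟘 ≤ y → 𝟘 ≤ x * y
  0≤x*y (inj₁ 0<x)  (inj₁ 0<y)  = inj₁ (*-pos _ _ 0<x 0<y)
  0≤x*y (inj₂ refl) _           = inj₂ (sym (zeroˡ _))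
  0≤x*y (inj₁ _)    (inj₂ refl) = inj₂ (sym (zeroʳ _))

  1≤x⇒0≤x-1 : ∀ {x} → 𝟙 ≤ x → 𝟘 ≤ x - 𝟙
  1≤x⇒0≤x-1 (inj₁ 1<x)  = inj₁ (x<y⇒0<y-x 1<x)
  1≤x⇒0≤x-1 (inj₂ refl) = inj₂ (sym (-‿inverseʳ 𝟙))

  x<0⇒y<0⇒x+y<0 : ∀ {x y} → x < 𝟘 → y < 𝟘 → x + y < 𝟘
  x<0⇒y<0⇒x+y<0 {x} {y} x<0 y<0 =
    subst₂ _<_ (+-idˡ (x + y)) (+-invˡ (x + y)) (+-mono-< 𝟘 (- (x + y)) (x + y) 0<-[x+y])
    where
    0<-[x+y] : 𝟘 < - (x + y)
    0<-[x+y] = subst (𝟘 <_) (-‿+-comm x y) (0<x⇒0<x+y (x<0⇒0<-x x<0) (inj₁ (x<0⇒0<-x y<0)))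

  0<1 : 𝟘 < 𝟙
  0<1 with <-tri 𝟘 𝟙
  ... | inj₁ 0<1        = 0<1
  ... | inj₂ (inj₁ 0≡1) = contradiction 0≡1 𝟘≢𝟙
  ... | inj₂ (inj₂ 1<0) = contradiction (<-trans 𝟙 𝟘 𝟙 1<0 0<[-1]*[-1]) (<-irrefl 𝟙)
    where
    0<[-1]*[-1] : 𝟘 < 𝟙
    0<[-1]*[-1] = subst (𝟘 <_) (solve 0 (:- con (ℤ.+ 1) :* :- con (ℤ.+ 1) := con (ℤ.+ 1)) refl)
      (*-pos _ _ (x<0⇒0<-x 1<0) (x<0⇒0<-x 1<0))

  0<fromℕ[1+n] : ∀ n → 𝟘 < fromℕ (suc n)
  0<fromℕ[1+n] zero    = 0<1
  0<fromℕ[1+n] (suc n) = subst (𝟘 <_) (sym (fromℕ-suc (suc n))) (0<x⇒0<x+y 0<1 (inj₁ (0<fromℕ[1+n] n)))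

  *-cancelʳ-≡0 : ∀ {x y} → y ≢ 𝟘 → x * y ≡ 𝟘 → x ≡ 𝟘
  *-cancelʳ-≡0 {x} {y} y≢0 xy≡0 with *-inv y y≢0
  ... | z , zy≡1 = begin
    x              ≡⟨ sym (*-identityʳ x) ⟩
    x * 𝟙          ≡⟨ cong (x *_) (trans (sym zy≡1) (*-comm z y)) ⟩
    x * (y * z)    ≡⟨ sym (*-assoc x y z) ⟩
    (x * y) * z    ≡⟨ cong (_* z) xy≡0 ⟩
    𝟘 * z          ≡⟨ zeroˡ z ⟩
    𝟘              ∎
    where open ≡-Reasoning

  x-y≡0⇒x≡y : ∀ {x y} → x - y ≡ 𝟘 → x ≡ y
  x-y≡0⇒x≡y {x} {y} x-y≡0 = begin
    x                ≡⟨ solve 2 (λ x y → x := (x :- y) :+ y) refl x y ⟩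
    (x - y) + y      ≡⟨ cong (_+ y) x-y≡0 ⟩
    𝟘 + y            ≡⟨ +-idˡ y ⟩
    y                ∎
    where open ≡-Reasoning

  *-cancelˡ-≡ : ∀ {k x y} → k ≢ 𝟘 → k * x ≡ k * y → x ≡ y
  *-cancelˡ-≡ {k} {x} {y} k≢0 kx≡ky = x-y≡0⇒x≡y (*-cancelʳ-≡0 k≢0 [x-y]k≡0)
    where
    [x-y]k≡0 : (x - y) * k ≡ 𝟘
    [x-y]k≡0 = begin
      (x - y) * k        ≡⟨ solve 3 (λ k x y → (x :- y) :* k := k :* x :- k :* y) refl k x y ⟩
      k * x - k * y      ≡⟨ cong (_- k * y) kx≡ky ⟩
      k * y - k * y      ≡⟨ -‿inverseʳ (k * y) ⟩
      𝟘                  ∎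
      where open ≡-Reasoning

  x≡-x⇒x≡0 : ∀ {x} → x ≡ - x → x ≡ 𝟘
  x≡-x⇒x≡0 {x} x≡-x = *-cancelˡ-≡ (0<x⇒x≢0 (0<fromℕ[1+n] 1)) (begin
    fromℕ 2 * x        ≡⟨ solve 1 (λ x → con (ℤ.+ 2) :* x := x :+ x) refl x ⟩
    x + x              ≡⟨ cong (x +_) x≡-x ⟩
    x - x              ≡⟨ -‿inverseʳ x ⟩
    𝟘                  ≡⟨ sym (zeroʳ _) ⟩
    fromℕ 2 * 𝟘        ∎)
    where open ≡-Reasoning

  negative-square-root-unique : ∀ {x y} → x < 𝟘 → y < 𝟘 → x * x ≡ y * y → x ≡ y
  negative-square-root-unique {x} {y} x<0 y<0 x²≡y² =
    x-y≡0⇒x≡y (*-cancelʳ-≡0 (λ x+y≡0 → <-irrefl 𝟘 (subst (_< 𝟘) x+y≡0 (x<0⇒y<0⇒x+y<0 x<0 y<0))) (begin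
      (x - y) * (x + y)  ≡⟨ solve 2 (λ x y → (x :- y) :* (x :+ y) := x :* x :- y :* y) refl x y ⟩
      x * x - y * y      ≡⟨ cong (_- y * y) x²≡y² ⟩
      y * y - y * y      ≡⟨ -‿inverseʳ (y * y) ⟩
      𝟘                  ∎))
    where open ≡-Reasoning

module PlaneGeometry (R : RealField) where
  open RealField R
  open RealFieldRing R
  open RealFieldOrder R
  open Geometry R

  infixl 6 _-ᵥ_
  infixl 7 _*ᶜ_

  _-ᵥ_ : Point → Point → Point
  (x₁ , y₁) -ᵥ (x₂ , y₂) = x₁ - x₂ , y₁ - y₂

  -- Complex multiplication, reading (x , y) as x + iy.
  _*ᶜ_ : Point → Point → Point
  (x₁ , y₁) *ᶜ (x₂ , y₂) = x₁ * x₂ - y₁ * y₂ , x₁ * y₂ + y₁ * x₂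

  real : ℝ → Point
  real x = x , 𝟘

  private
    infixl 6 _-ᴾ_
    infixl 7 _*ᴾ_

    Pointᴾ : ℕ → Set
    Pointᴾ m = Polynomial m × Polynomial m

    orientᴾ : ∀ {m} → Pointᴾ m → Pointᴾ m → Pointᴾ m → Polynomial m
    orientᴾ (ax , ay) (bx , by) (cx , cy) = (bx :- ax) :* (cy :- ay) :- (by :- ay) :* (cx :- ax)

    dist²ᴾ : ∀ {m} → Pointᴾ m → Pointᴾ m → Polynomial m
    dist²ᴾ (x₁ , y₁) (x₂ , y₂) = (x₁ :- x₂) :* (x₁ :- x₂) :+ (y₁ :- y₂) :* (y₁ :- y₂)

    _-ᴾ_ : ∀ {m} → Pointᴾ m → Pointᴾ m → Pointᴾ m
    (x₁ , y₁) -ᴾ (x₂ , y₂) = x₁ :- x₂ , y₁ :- y₂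

    _*ᴾ_ : ∀ {m} → Pointᴾ m → Pointᴾ m → Pointᴾ m
    (x₁ , y₁) *ᴾ (x₂ , y₂) = x₁ :* x₂ :- y₁ :* y₂ , x₁ :* y₂ :+ y₁ :* x₂

    realᴾ : ∀ {m} → Polynomial m → Pointᴾ m
    realᴾ x = x , con (ℤ.+ 0)

  dist²-sym : ∀ P Q → dist² P Q ≡ dist² Q P
  dist²-sym (px , py) (qx , qy) =
    solve 4 (λ px py qx qy → dist²ᴾ (px , py) (qx , qy) := dist²ᴾ (qx , qy) (px , py)) refl px py qx qy

  orient-rotate : ∀ A B C → orient A B C ≡ orient B C A
  orient-rotate (ax , ay) (bx , by) (cx , cy) =
    solve 6 (λ ax ay bx by cx cy → orientᴾ (ax , ay) (bx , by) (cx , cy) := orientᴾ (bx , by) (cx , cy) (ax , ay))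
      refl ax ay bx by cx cy

  UnitTriangle : Point → Point → Point → Set
  UnitTriangle A B C = dist² A B ≡ 𝟙 × dist² A C ≡ 𝟙 × dist² B C ≡ 𝟙

  ClockwiseUnitTriangle : Point → Point → Point → Set
  ClockwiseUnitTriangle A B C = UnitTriangle A B C × orient A B C < 𝟘

  orient-Heron : ∀ {a b c} A B C → dist² A B ≡ a → dist² A C ≡ b → dist² B C ≡ c →
    (fromℕ 2 * orient A B C) * (fromℕ 2 * orient A B C) ≡ fromℕ 4 * a * b - (a + b - c) * (a + b - c)
  orient-Heron (ax , ay) (bx , by) (cx , cy) refl refl refl =
    solve 6 (λ ax ay bx by cx cy →
      let A = (ax , ay) ; B = (bx , by) ; C = (cx , cy)
          σ = con (ℤ.+ 2) :* orientᴾ A B C ; a = dist²ᴾ A B ; b = dist²ᴾ A C ; c = dist²ᴾ B C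
      in σ :* σ := con (ℤ.+ 4) :* a :* b :- (a :+ b :- c) :* (a :+ b :- c))
      refl ax ay bx by cx cy

  -- The law of cosines and the signed area combined: the complex number
  -- conj(B - A) (C - A) equals ((a + b - c) + 2i orient A B C) / 2.
  apex-identity : ∀ {a b c} A B C → dist² A B ≡ a → dist² A C ≡ b → dist² B C ≡ c →
    real (fromℕ 2 * a) *ᶜ (C -ᵥ A) ≡ (a + b - c , fromℕ 2 * orient A B C) *ᶜ (B -ᵥ A)
  apex-identity (ax , ay) (bx , by) (cx , cy) refl refl refl = cong₂ _,_
    (solve 6 (λ ax ay bx by cx cy → proj₁ (lhs (ax , ay) (bx , by) (cx , cy)) := proj₁ (rhs (ax , ay) (bx , by) (cx , cy)))
      refl ax ay bx by cx cy)
    (solve 6 (λ ax ay bx by cx cy → proj₂ (lhs (ax , ay) (bx , by) (cx , cy)) := proj₂ (rhs (ax , ay) (bx , by) (cx , cy)))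
      refl ax ay bx by cx cy)
    where
    lhs rhs : Pointᴾ 6 → Pointᴾ 6 → Pointᴾ 6 → Pointᴾ 6
    lhs A B C = realᴾ (con (ℤ.+ 2) :* dist²ᴾ A B) *ᴾ (C -ᴾ A)
    rhs A B C = (dist²ᴾ A B :+ dist²ᴾ A C :- dist²ᴾ B C , con (ℤ.+ 2) :* orientᴾ A B C) *ᴾ (B -ᴾ A)

  unitTriangle-[2orient]² : ∀ {A B C} → UnitTriangle A B C →
    (fromℕ 2 * orient A B C) * (fromℕ 2 * orient A B C) ≡ fromℕ 3
  unitTriangle-[2orient]² {A} {B} {C} (ab , ac , bc) = trans (orient-Heron A B C ab ac bc)
    (solve 0 (con (ℤ.+ 4) :* one :* one :- (one :+ one :- one) :* (one :+ one :- one) := con (ℤ.+ 3)) refl)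
    where one = con (ℤ.+ 1)

  unitTriangle-apex : ∀ {A B C} → UnitTriangle A B C →
    real (fromℕ 2) *ᶜ (C -ᵥ A) ≡ (𝟙 , fromℕ 2 * orient A B C) *ᶜ (B -ᵥ A)
  unitTriangle-apex {A} {B} {C} (ab , ac , bc) = begin
    real (fromℕ 2) *ᶜ (C -ᵥ A)       ≡⟨ cong (λ k → real k *ᶜ (C -ᵥ A)) (solve 0 (two := two :* one) refl) ⟩
    real (fromℕ 2 * 𝟙) *ᶜ (C -ᵥ A)   ≡⟨ apex-identity A B C ab ac bc ⟩
    (𝟙 + 𝟙 - 𝟙 , σ) *ᶜ (B -ᵥ A)      ≡⟨ cong (λ k → (k , σ) *ᶜ (B -ᵥ A)) (solve 0 (one :+ one :- one := one) refl) ⟩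
    (𝟙 , σ) *ᶜ (B -ᵥ A)              ∎
    where
    open ≡-Reasoning
    σ = fromℕ 2 * orient A B C
    one two : Polynomial 0
    one = con (ℤ.+ 1)
    two = con (ℤ.+ 2)

  real-*ᶜ-swap : ∀ k z u → real k *ᶜ (z *ᶜ u) ≡ z *ᶜ (real k *ᶜ u)
  real-*ᶜ-swap k (zx , zy) (ux , uy) = cong₂ _,_
    (solve 5 (λ k zx zy ux uy → proj₁ (realᴾ k *ᴾ ((zx , zy) *ᴾ (ux , uy))) := proj₁ ((zx , zy) *ᴾ (realᴾ k *ᴾ (ux , uy))))
      refl k zx zy ux uy)
    (solve 5 (λ k zx zy ux uy → proj₂ (realᴾ k *ᴾ ((zx , zy) *ᴾ (ux , uy))) := proj₂ ((zx , zy) *ᴾ (realᴾ k *ᴾ (ux , uy))))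
      refl k zx zy ux uy)

  real-*ᶜ : ∀ k u → real k *ᶜ u ≡ (k * proj₁ u , k * proj₂ u)
  real-*ᶜ k (ux , uy) = cong₂ _,_
    (solve 3 (λ k ux uy → proj₁ (realᴾ k *ᴾ (ux , uy)) := k :* ux) refl k ux uy)
    (solve 3 (λ k ux uy → proj₂ (realᴾ k *ᴾ (ux , uy)) := k :* uy) refl k ux uy)

  real-*ᶜ-cancel : ∀ {k u v} → k ≢ 𝟘 → real k *ᶜ u ≡ real k *ᶜ v → u ≡ v
  real-*ᶜ-cancel {k} {u} {v} k≢0 ku≡kv =
    cong₂ _,_ (*-cancelˡ-≡ k≢0 (cong proj₁ scaled)) (*-cancelˡ-≡ k≢0 (cong proj₂ scaled))
    where
    scaled : (k * proj₁ u , k * proj₂ u) ≡ (k * proj₁ v , k * proj₂ v)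
    scaled = trans (sym (real-*ᶜ k u)) (trans ku≡kv (real-*ᶜ k v))

  [1+iσ]³ : ∀ {σ} u → σ * σ ≡ fromℕ 3 → (𝟙 , σ) *ᶜ ((𝟙 , σ) *ᶜ ((𝟙 , σ) *ᶜ u)) ≡ real (- fromℕ 8) *ᶜ u
  [1+iσ]³ {σ} (ux , uy) σ²≡3 = cong₂ _,_
    (begin
      proj₁ (ω³ (ux , uy))                   ≡⟨ solve 3 (λ σ ux uy → proj₁ (ωᴾ³ σ (ux , uy)) := xᴾ (σ :* σ) σ ux uy) refl σ ux uy ⟩
      x (σ * σ)                              ≡⟨ cong x σ²≡3 ⟩
      x (fromℕ 3)                            ≡⟨ solve 3 (λ σ ux uy → xᴾ three σ ux uy := proj₁ (-8ᴾ *ᴾ (ux , uy))) refl σ ux uy ⟩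
      proj₁ (real (- fromℕ 8) *ᶜ (ux , uy))  ∎)
    (begin
      proj₂ (ω³ (ux , uy))                   ≡⟨ solve 3 (λ σ ux uy → proj₂ (ωᴾ³ σ (ux , uy)) := yᴾ (σ :* σ) σ ux uy) refl σ ux uy ⟩
      y (σ * σ)                              ≡⟨ cong y σ²≡3 ⟩
      y (fromℕ 3)                            ≡⟨ solve 3 (λ σ ux uy → yᴾ three σ ux uy := proj₂ (-8ᴾ *ᴾ (ux , uy))) refl σ ux uy ⟩
      proj₂ (real (- fromℕ 8) *ᶜ (ux , uy))  ∎)
    where
    open ≡-Reasoning
    ω³ : Point → Point
    ω³ u = (𝟙 , σ) *ᶜ ((𝟙 , σ) *ᶜ ((𝟙 , σ) *ᶜ u))
    x y : ℝ → ℝ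
    x q = (𝟙 - fromℕ 3 * q) * ux - σ * (fromℕ 3 - q) * uy
    y q = (𝟙 - fromℕ 3 * q) * uy + σ * (fromℕ 3 - q) * ux
    one three : Polynomial 3
    one = con (ℤ.+ 1)
    three = con (ℤ.+ 3)
    -8ᴾ : Pointᴾ 3
    -8ᴾ = realᴾ (:- con (ℤ.+ 8))
    ωᴾ³ : Polynomial 3 → Pointᴾ 3 → Pointᴾ 3
    ωᴾ³ σ u = (one , σ) *ᴾ ((one , σ) *ᴾ ((one , σ) *ᴾ u))
    xᴾ yᴾ : Polynomial 3 → Polynomial 3 → Polynomial 3 → Polynomial 3 → Polynomial 3
    xᴾ q σ ux uy = (one :- three :* q) :* ux :- σ :* (three :- q) :* uy
    yᴾ q σ ux uy = (one :- three :* q) :* uy :+ σ :* (three :- q) :* ux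

  three-sixth-turns : ∀ {σ u₁ u₂ u₃ u₄} → σ * σ ≡ fromℕ 3 →
    real (fromℕ 2) *ᶜ u₂ ≡ (𝟙 , σ) *ᶜ u₁ → real (fromℕ 2) *ᶜ u₃ ≡ (𝟙 , σ) *ᶜ u₂ → real (fromℕ 2) *ᶜ u₄ ≡ (𝟙 , σ) *ᶜ u₃ →
    real (fromℕ 8) *ᶜ u₄ ≡ real (- fromℕ 8) *ᶜ u₁
  three-sixth-turns {σ} {u₁} {u₂} {u₃} {u₄} σ²≡3 e₁ e₂ e₃ = begin
    real (fromℕ 8) *ᶜ u₄        ≡⟨ eight≡two³ u₄ ⟩
    two *ᶜ (two *ᶜ (two *ᶜ u₄)) ≡⟨ cong (λ v → two *ᶜ (two *ᶜ v)) e₃ ⟩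
    two *ᶜ (two *ᶜ (ω *ᶜ u₃))   ≡⟨ cong (two *ᶜ_) (real-*ᶜ-swap _ ω u₃) ⟩
    two *ᶜ (ω *ᶜ (two *ᶜ u₃))   ≡⟨ cong (λ v → two *ᶜ (ω *ᶜ v)) e₂ ⟩
    two *ᶜ (ω *ᶜ (ω *ᶜ u₂))     ≡⟨ real-*ᶜ-swap _ ω (ω *ᶜ u₂) ⟩
    ω *ᶜ (two *ᶜ (ω *ᶜ u₂))     ≡⟨ cong (ω *ᶜ_) (real-*ᶜ-swap _ ω u₂) ⟩
    ω *ᶜ (ω *ᶜ (two *ᶜ u₂))     ≡⟨ cong (λ v → ω *ᶜ (ω *ᶜ v)) e₁ ⟩
    ω *ᶜ (ω *ᶜ (ω *ᶜ u₁))       ≡⟨ [1+iσ]³ u₁ σ²≡3 ⟩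
    real (- fromℕ 8) *ᶜ u₁      ∎
    where
    open ≡-Reasoning
    ω two : Point
    ω = 𝟙 , σ
    two = real (fromℕ 2)
    eight≡two³ : ∀ u → real (fromℕ 8) *ᶜ u ≡ two *ᶜ (two *ᶜ (two *ᶜ u))
    eight≡two³ (ux , uy) = cong₂ _,_
      (solve 2 (λ ux uy → proj₁ (realᴾ (con (ℤ.+ 8)) *ᴾ (ux , uy)) := proj₁ (twoᴾ *ᴾ (twoᴾ *ᴾ (twoᴾ *ᴾ (ux , uy))))) refl ux uy)
      (solve 2 (λ ux uy → proj₂ (realᴾ (con (ℤ.+ 8)) *ᴾ (ux , uy)) := proj₂ (twoᴾ *ᴾ (twoᴾ *ᴾ (twoᴾ *ᴾ (ux , uy))))) refl ux uy)
      where
      twoᴾ : Pointᴾ 2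
      twoᴾ = realᴾ (con (ℤ.+ 2))

  clockwise-unitTriangle-[2orient]-unique : ∀ {A B C A′ B′ C′} →
    ClockwiseUnitTriangle A B C → ClockwiseUnitTriangle A′ B′ C′ →
    fromℕ 2 * orient A B C ≡ fromℕ 2 * orient A′ B′ C′
  clockwise-unitTriangle-[2orient]-unique (t , o<0) (t′ , o′<0) =
    negative-square-root-unique (2x<0 o<0) (2x<0 o′<0)
      (trans (unitTriangle-[2orient]² t) (sym (unitTriangle-[2orient]² t′)))
    where
    2x<0 : ∀ {x} → x < 𝟘 → fromℕ 2 * x < 𝟘
    2x<0 {x} x<0 = subst (_< 𝟘) (solve 1 (λ x → x :+ x := con (ℤ.+ 2) :* x) refl x) (x<0⇒y<0⇒x+y<0 x<0 x<0)

  half-turn : ∀ {A B₁ B₂ B₃ B₄} →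
    ClockwiseUnitTriangle A B₁ B₂ → ClockwiseUnitTriangle A B₂ B₃ → ClockwiseUnitTriangle A B₃ B₄ →
    B₄ -ᵥ A ≡ A -ᵥ B₁
  half-turn {A} {B₁} {B₂} {B₃} {B₄} t₁ t₂ t₃ = real-*ᶜ-cancel (0<x⇒x≢0 (0<fromℕ[1+n] 7)) (begin
    real (fromℕ 8) *ᶜ (B₄ -ᵥ A)        ≡⟨ three-sixth-turns (unitTriangle-[2orient]² (proj₁ t₁))
                                            (unitTriangle-apex (proj₁ t₁)) (sixth-turn t₂) (sixth-turn t₃) ⟩
    real (- fromℕ 8) *ᶜ (B₁ -ᵥ A)      ≡⟨ negate-point B₁ A ⟩
    real (fromℕ 8) *ᶜ (A -ᵥ B₁)        ∎)
    where
    open ≡-Reasoning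
    sixth-turn : ∀ {B C} → ClockwiseUnitTriangle A B C →
      real (fromℕ 2) *ᶜ (C -ᵥ A) ≡ (𝟙 , fromℕ 2 * orient A B₁ B₂) *ᶜ (B -ᵥ A)
    sixth-turn {B} {C} t = subst (λ σ → real (fromℕ 2) *ᶜ (C -ᵥ A) ≡ (𝟙 , σ) *ᶜ (B -ᵥ A))
      (clockwise-unitTriangle-[2orient]-unique t t₁) (unitTriangle-apex (proj₁ t))
    negate-point : ∀ P Q → real (- fromℕ 8) *ᶜ (P -ᵥ Q) ≡ real (fromℕ 8) *ᶜ (Q -ᵥ P)
    negate-point (px , py) (qx , qy) = cong₂ _,_
      (solve 4 (λ px py qx qy → proj₁ (-8ᴾ *ᴾ ((px , py) -ᴾ (qx , qy))) := proj₁ (8ᴾ *ᴾ ((qx , qy) -ᴾ (px , py))))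
        refl px py qx qy)
      (solve 4 (λ px py qx qy → proj₂ (-8ᴾ *ᴾ ((px , py) -ᴾ (qx , qy))) := proj₂ (8ᴾ *ᴾ ((qx , qy) -ᴾ (px , py))))
        refl px py qx qy)
      where
      8ᴾ -8ᴾ : Pointᴾ 4
      8ᴾ = realᴾ (con (ℤ.+ 8))
      -8ᴾ = realᴾ (:- con (ℤ.+ 8))

  midpoint⇒collinear : ∀ {A B C} → C -ᵥ A ≡ A -ᵥ B → orient B A C ≡ 𝟘
  midpoint⇒collinear {ax , ay} {bx , by} {cx , cy} C-A≡A-B = begin
    orient (bx , by) (ax , ay) (cx , cy)        ≡⟨ solve 6 (λ ax ay bx by cx cy → orientᴾ (bx , by) (ax , ay) (cx , cy) := fᴾ ax ay bx by (cx :- ax) (cy :- ay))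
                                                     refl ax ay bx by cx cy ⟩
    f (cx - ax) (cy - ay)                       ≡⟨ cong₂ f (cong proj₁ C-A≡A-B) (cong proj₂ C-A≡A-B) ⟩
    f (ax - bx) (ay - by)                       ≡⟨ solve 4 (λ ax ay bx by → fᴾ ax ay bx by (ax :- bx) (ay :- by) := con (ℤ.+ 0))
                                                     refl ax ay bx by ⟩
    𝟘                                           ∎
    where
    open ≡-Reasoning
    f : ℝ → ℝ → ℝ
    f vx vy = (ax - bx) * (vy + (ay - by)) - (ay - by) * (vx + (ax - bx))
    fᴾ : ∀ {m} → (ax ay bx by vx vy : Polynomial m) → Polynomial m
    fᴾ ax ay bx by vx vy = (ax :- bx) :* (vy :+ (ay :- by)) :- (ay :- by) :* (vx :+ (ax :- bx))

  self-opposite⇒dist²≡0 : ∀ {A B} → B -ᵥ A ≡ A -ᵥ B → dist² A B ≡ 𝟘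
  self-opposite⇒dist²≡0 {ax , ay} {bx , by} B-A≡A-B = begin
    (ax - bx) * (ax - bx) + (ay - by) * (ay - by) ≡⟨ cong₂ (λ dx dy → dx * dx + dy * dy)
                                                       (x≡-x⇒x≡0 (antisym ax bx (cong proj₁ B-A≡A-B)))
                                                       (x≡-x⇒x≡0 (antisym ay by (cong proj₂ B-A≡A-B))) ⟩
    𝟘 * 𝟘 + 𝟘 * 𝟘                                 ≡⟨ solve 0 (con (ℤ.+ 0) :* con (ℤ.+ 0) :+ con (ℤ.+ 0) :* con (ℤ.+ 0) := con (ℤ.+ 0)) refl ⟩
    𝟘                                             ∎
    where
    open ≡-Reasoning
    antisym : ∀ a b → b - a ≡ a - b → a - b ≡ - (a - b)
    antisym a b b-a≡a-b = trans (solve 2 (λ a b → a :- b := :- (b :- a)) refl a b) (cong (λ x → - x) b-a≡a-b)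

  far-point-identity : ∀ {k a b c} B C A Z → dist² B Z ≡ k → dist² B C ≡ a → dist² B A ≡ b → dist² C A ≡ c →
    orient B C A * (dist² Z C - 𝟙) + orient B C A * (dist² Z A - 𝟙) + fromℕ 3 * (- orient Z C A) + orient B C A
      ≡ orient B C A * (k + k + a + b - fromℕ 4) + orient B Z A * (fromℕ 3 - fromℕ 3 * a - b + c)
        + orient B C Z * (fromℕ 3 - a - fromℕ 3 * b + c)
  far-point-identity (bx , by) (cx , cy) (ax , ay) (zx , zy) refl refl refl refl =
    solve 8 (λ bx by cx cy ax ay zx zy →
      let B = (bx , by) ; C = (cx , cy) ; A = (ax , ay) ; Z = (zx , zy)
          S = orientᴾ B C A ; one = con (ℤ.+ 1) ; three = con (ℤ.+ 3)
          k = dist²ᴾ B Z ; a = dist²ᴾ B C ; b = dist²ᴾ B A ; c = dist²ᴾ C A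
      in S :* (dist²ᴾ Z C :- one) :+ S :* (dist²ᴾ Z A :- one) :+ three :* (:- orientᴾ Z C A) :+ S
         := S :* (k :+ k :+ a :+ b :- con (ℤ.+ 4)) :+ orientᴾ B Z A :* (three :- three :* a :- b :+ c)
            :+ orientᴾ B C Z :* (three :- a :- three :* b :+ c))
      refl bx by cx cy ax ay zx zy

  -- Z is on the arc of the unit circle about B opposite to the chord CA,
  -- so ZCA and BCA have the same orientation.
  far-point-clockwise : ∀ B C A Z → dist² B Z ≡ 𝟙 → dist² B C ≡ 𝟙 → dist² B A ≡ 𝟙 → dist² C A ≡ 𝟙 →
    𝟙 ≤ dist² Z C → 𝟙 ≤ dist² Z A → orient Z C A < 𝟘 → orient B C A ≢ 𝟘 → orient B C A < 𝟘
  far-point-clockwise B C A Z bz bc ba ca 1≤zc 1≤za zca<0 bca≢0 with <-tri (orient B C A) 𝟘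
  ... | inj₁ bca<0        = bca<0
  ... | inj₂ (inj₁ bca≡0) = contradiction bca≡0 bca≢0
  ... | inj₂ (inj₂ 0<bca) = contradiction (trans (far-point-identity B C A Z bz bc ba ca) rhs≡0) (0<x⇒x≢0 0<lhs)
    where
    0<lhs : 𝟘 < orient B C A * (dist² Z C - 𝟙) + orient B C A * (dist² Z A - 𝟙) + fromℕ 3 * (- orient Z C A) + orient B C A
    0<lhs = 0<y⇒0<x+y
      (0≤x+y (0≤x+y (0≤x*y (inj₁ 0<bca) (1≤x⇒0≤x-1 1≤zc)) (0≤x*y (inj₁ 0<bca) (1≤x⇒0≤x-1 1≤za)))
             (inj₁ (*-pos _ _ (0<fromℕ[1+n] 2) (x<0⇒0<-x zca<0))))
      0<bca
    rhs≡0 : orient B C A * (𝟙 + 𝟙 + 𝟙 + 𝟙 - fromℕ 4) + orient B Z A * (fromℕ 3 - fromℕ 3 * 𝟙 - 𝟙 + 𝟙)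
              + orient B C Z * (fromℕ 3 - 𝟙 - fromℕ 3 * 𝟙 + 𝟙) ≡ 𝟘
    rhs≡0 = solve 3 (λ S X Y → let one = con (ℤ.+ 1) ; three = con (ℤ.+ 3) in
      S :* (one :+ one :+ one :+ one :- con (ℤ.+ 4)) :+ X :* (three :- three :* one :- one :+ one)
        :+ Y :* (three :- one :- three :* one :+ one) := con (ℤ.+ 0))
      refl (orient B C A) (orient B Z A) (orient B C Z)

module PennyGraph (R : RealField) {n : ℕ} (p : Fin n → Geometry.Point R)
                  (penny : Geometry.IsPennyPointSet R p) (general : Geometry.GeneralPosition R p) where
  open RealField R
  open Geometry R
  open PlaneGeometry R

  Adj-sym : ∀ {i j} → Adj p i j → Adj p j i
  Adj-sym {i} {j} (i≢j , dist²≡1) = (λ j≡i → i≢j (sym j≡i)) , trans (dist²-sym (p j) (p i)) dist²≡1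

  typeII⇒clockwise-neighbour : ∀ {a b} → TypeII p a b →
    ∃ λ c → Adj p a c × ClockwiseUnitTriangle (p a) (p b) (p c)
  typeII⇒clockwise-neighbour {b = b} (_ , c , c-injective , b~c , _ , clockwise , _ , _ , c₄~c₅ , refl) =
    c (# 3) , Adj-sym c₄~c₅ , (trans (dist²-sym A B) BA≡1 , proj₂ (Adj-sym c₄~c₅) , BC≡1) , ABC-clockwise
    where
    A B C Z : Point
    A = p (c (# 4))
    B = p b
    C = p (c (# 3))
    Z = p (c (# 0))
    BA≡1 : dist² B A ≡ 𝟙
    BA≡1 = proj₂ (b~c (# 4))
    BC≡1 : dist² B C ≡ 𝟙
    BC≡1 = proj₂ (b~c (# 3))
    ABC-clockwise : orient A B C < 𝟘
    ABC-clockwise = subst (_< 𝟘) (sym (orient-rotate A B C))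
      (far-point-clockwise B C A Z (proj₂ (b~c (# 0))) BC≡1 BA≡1 (proj₂ c₄~c₅)
        (penny (c (# 0)) (c (# 3)) (λ c₁≡c₄ → contradiction (c-injective c₁≡c₄) λ ()))
        (penny (c (# 0)) (c (# 4)) (λ c₁≡c₅ → contradiction (c-injective c₁≡c₅) λ ()))
        (clockwise (# 0) (# 3) (# 4) ℕ.z<s (n<1+n 3))
        (general b (c (# 3)) (c (# 4)) (proj₁ (b~c (# 3))) (proj₁ c₄~c₅) (proj₁ (b~c (# 4)))))

  no-antipodal-neighbours : ∀ {a b b′} → Adj p a b → Adj p a b′ → ¬ (p b′ -ᵥ p a ≡ p a -ᵥ p b)
  no-antipodal-neighbours {a} {b} {b′} a~b a~b′ antipodal with b Fin.≟ b′
  ... | yes refl = 𝟘≢𝟙 (trans (sym (self-opposite⇒dist²≡0 antipodal)) (proj₂ a~b))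
  ... | no b≢b′  = general b a b′ (λ b≡a → proj₁ a~b (sym b≡a)) (proj₁ a~b′) b≢b′ (midpoint⇒collinear antipodal)

  neighbours-not-all-typeII : ∀ {a b} → Adj p a b → ¬ (∀ b′ → Adj p a b′ → TypeII p a b′)
  neighbours-not-all-typeII {b = b₁} a~b₁ all-typeII
    with typeII⇒clockwise-neighbour (all-typeII b₁ a~b₁)
  ... | b₂ , a~b₂ , t₁ with typeII⇒clockwise-neighbour (all-typeII b₂ a~b₂)
  ... | b₃ , a~b₃ , t₂ with typeII⇒clockwise-neighbour (all-typeII b₃ a~b₃)
  ... | b₄ , a~b₄ , t₃ = no-antipodal-neighbours a~b₁ a~b₄ (half-turn t₁ t₂ t₃)

proposition4 : (R : RealField) → let open Geometry R in
    ∀ (n : ℕ) (p : Fin n → Point) → IsPennyPointSet p → GeneralPosition p →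
    ∀ (a : Fin n) → HasDegree p a 4 →
    ¬ (∀ b → Adj p a b → TypeII p a b)
proposition4 R n p penny general a (_ , _ , _ , a~neighbour) =
  PennyGraph.neighbours-not-all-typeII R p penny general (a~neighbour zero)
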